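{- With $\beta=q+q^{ -1}$, we have $$(A^*)^3A-(\beta+1)(A^*)^2AA^*+(\beta+1)A^*A(A^*)^2-A(A^*)^3=0.$$
   Context: Let $\mathbb F_q$ be a finite field with $q$ elements, let $N,M$ be positive integers, let $H$ be a vector space over $\mathbb F_q$ of dimension $N+M$, and fix a subspace $h\subseteq H$ of dimension $M$. Let $X$ be the set of subspaces $y\subseteq H$ with $y\cap h=0$, partially ordered by inclusion (the Attenuated Space poset $\mathcal A_q(N,M)$). For $y,z\in X$, $z$ covers $y$ when $y\subseteq z$ and $\dim z-\dim y=1$; $y,z$ are adjacent when one of them covers the other. Let $\mathrm{Mat}_X(\mathbb C)$ be the algebra of complex matrices with rows and columns indexed by $X$. The matrix $A\in\mathrm{Mat}_X(\mathbb C)$ has $(y,z)$-entry $1$ if $y$ covers $z$; $q^{\dim y}$ if $z$ covers $y$; and $0$ if $y,z$ are not adjacent. The matrix $A^*\in\mathrm{Mat}_X(\mathbb C)$ is diagonal with $(y,y)$-entry $q^{ -\dim y}$ for $y\in X$. -}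

module Defs where

open import Algebra.Apartness.Bundles using (HeytingField; HeytingCommutativeRing)
open import Algebra.Bundles using (CommutativeRing)
import Algebra.Consequences.Setoid
open import Algebra.Core using (Op₁; Op₂)
import Algebra.Definitions
open import Algebra.Module.Bundles using (Module)
import Algebra.Properties.CommutativeMonoid.Sum
import Algebra.Properties.Group
import Algebra.Properties.Ring
import Algebra.Properties.Semiring.Exp
import Algebra.Solver.Ring.NaturalCoefficients.Default
open import Algebra.Structures using (IsCommutativeRing)
open import Data.Bool.Base using (if_then_else_)
import Data.Bool.Properties as Bool
open import Data.Empty using (⊥-elim-irr)
open import Data.Fin.Base using (Fin; zero; suc; finToFun; funToFin)
import Data.Fin.Properties as Fin
open import Data.Fin.Subset using (Subset; inside; outside; _∈_; _⊆_)
open import Data.Fin.Subset.Properties using (_∈?_; _⊆?_)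
open import Data.Integer.Base using (+_)
open import Data.Irrelevant using ([_])
open import Data.List.Base as List using (List; []; _∷_; mapMaybe; foldr)
open import Data.List.Membership.Propositional using () renaming (_∈_ to _∈ˡ_)
open import Data.List.Membership.Propositional.Properties using (∈-++⁺ˡ; ∈-++⁺ʳ; ∈-map⁺; ∈-map⁻)
open import Data.List.Relation.Unary.All as All using ([])
import Data.List.Relation.Unary.All.Properties as All
open import Data.List.Relation.Unary.Any as Any using (here)
import Data.List.Relation.Unary.Any.Properties as Any
open import Data.List.Relation.Unary.Unique.Propositional using (Unique; []; _∷_)
import Data.List.Relation.Unary.Unique.Propositional.Properties as Unique
open import Data.Maybe.Base using (Maybe; just; nothing)
import Data.Maybe.Relation.Unary.All as Maybe
open import Data.Maybe.Relation.Unary.All using (just; nothing)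
import Data.Maybe.Relation.Unary.Any as Maybe
open import Data.Maybe.Relation.Unary.Any using (just)
open import Data.Nat.Base as ℕ using (ℕ; zero; suc; NonZero; _⊔_)
import Data.Nat.Properties as ℕ
open import Data.Product.Base using (∃; ∃-syntax; _×_; _,_; proj₁; proj₂)
import Data.Rational.Base
open import Data.Rational.Base as ℚ using (ℚ; 0ℚ; 1ℚ; ½; ∣_∣; positive; 1/_; _/_)
import Data.Rational.Properties as ℚ
open import Data.Rational.Solver using (module +-*-Solver)
open import Data.Refinement using (Refinement-syntax; _,_; value)
import Data.Refinement.Properties as Refinement
open import Data.Vec.Base using ([]; _∷_)
open import Data.Vec.Functional using (Vector) renaming (_∷_ to _◂_)
import Data.Vec.Properties as Vec
open import Function.Base using (_∘_)
open import Function.Bundles using (Inverse)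
open import Level using (0ℓ) renaming (suc to lsuc; _⊔_ to _⊔ˡ_)
open import Relation.Binary.Bundles using (Setoid)
open import Relation.Binary.Core using (Rel)
open import Relation.Binary.Definitions using (DecidableEquality)
open import Relation.Binary.PropositionalEquality as ≡ using (_≡_; _≢_; cong; subst)
import Relation.Binary.Reasoning.Setoid as ≈-Reasoning
open import Relation.Binary.Structures using (IsEquivalence)
open import Relation.Nullary.Decidable using (Dec; yes; no; does; map′; ¬?; _×-dec_; _→-dec_; decidable-stable)
open import Relation.Nullary.Negation using (¬_; contradiction)
open import Relation.Unary using (Pred; U; Decidable)

module _ {A : Set} {_≈_ : Rel A 0ℓ} {_+_ _*_ : Op₂ A} { -_ : Op₁ A} {0# 1# : A} where

  private module D = Algebra.Definitions _≈_

  mkIsCommutativeRing :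
    IsEquivalence _≈_ → D.Congruent₂ _+_ → D.Congruent₁ -_ → D.Congruent₂ _*_ →
    D.Associative _+_ → D.Commutative _+_ → D.LeftIdentity 0# _+_ → D.LeftInverse 0# -_ _+_ →
    D.Associative _*_ → D.Commutative _*_ → D.LeftIdentity 1# _*_ → _*_ D.DistributesOverˡ _+_ →
    IsCommutativeRing _≈_ _+_ _*_ -_ 0# 1#
  mkIsCommutativeRing isEquivalence +-cong neg-cong *-cong
    +-assoc +-comm +-identityˡ +-inverseˡ *-assoc *-comm *-identityˡ *-distribˡ-+ = record
    { isRing = record
      { +-isAbelianGroup = record
        { isGroup = record
          { isMonoid = record
            { isSemigroup = record
              { isMagma = record { isEquivalence = isEquivalence ; ∙-cong = +-cong }
              ; assoc = +-assoc
              }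
            ; identity = C.comm∧idˡ⇒id +-comm +-identityˡ
            }
          ; inverse = C.comm∧invˡ⇒inv +-comm +-inverseˡ
          ; ⁻¹-cong = neg-cong
          }
        ; comm = +-comm
        }
      ; *-cong     = *-cong
      ; *-assoc    = *-assoc
      ; *-identity = C.comm∧idˡ⇒id *-comm *-identityˡ
      ; distrib    = C.comm∧distrˡ⇒distr +-cong *-comm *-distribˡ-+
      }
    ; *-comm = *-comm
    }
    where
    setoid : Setoid 0ℓ 0ℓ
    setoid = record { isEquivalence = isEquivalence }

    module C = Algebra.Consequences.Setoid setoid

module Real where

  open Data.Rational.Base using (_<_; _≤_; _+_; _*_; _-_; -_)

  Cauchy : (ℕ → ℚ) → Set
  Cauchy x = ∀ ε → 0ℚ < ε → ∃[ N ] ∀ m n → N ℕ.≤ m → N ℕ.≤ n → ∣ x m - x n ∣ < ε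

  -- Real numbers are Cauchy sequences of rationals, with equality _≈_ below.
  record ℝ : Set where
    constructor _,_
    field
      seq    : ℕ → ℚ
      cauchy : Cauchy seq

  open ℝ public

  infix 4 _≈_
  record _≈_ (x y : ℝ) : Set where
    constructor mk≈
    field
      null : ∀ ε → 0ℚ < ε → ∃[ N ] ∀ n → N ℕ.≤ n → ∣ seq x n - seq y n ∣ < ε

  open _≈_

  private

    half : ∀ ε → 0ℚ < ε → 0ℚ < ½ * ε
    half ε ε>0 = ℚ.positive⁻¹ _ {{ℚ.pos*pos⇒pos ½ ε {{positive ε>0}}}}

    half+half : ∀ ε → ½ * ε + ½ * ε ≡ ε
    half+half ε = ≡.trans (≡.sym (ℚ.*-distribʳ-+ ε ½ ½)) (ℚ.*-identityˡ ε)

    ∣+∣<ε : ∀ {ε} a b → ∣ a ∣ < ½ * ε → ∣ b ∣ < ½ * ε → ∣ a + b ∣ < ε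
    ∣+∣<ε {ε} a b p r = subst (∣ a + b ∣ <_) (half+half ε)
      (ℚ.≤-<-trans (ℚ.∣p+q∣≤∣p∣+∣q∣ a b) (ℚ.+-mono-< p r))

    1/pos : ∀ B → 0ℚ < B → ℚ
    1/pos B B>0 = (1/ B) {{ℚ.pos⇒nonZero B {{positive B>0}}}}

    scale : ∀ B → 0ℚ < B → ℚ → ℚ
    scale B B>0 ε = 1/pos B B>0 * ε

    scale>0 : ∀ B (B>0 : 0ℚ < B) ε → 0ℚ < ε → 0ℚ < scale B B>0 ε
    scale>0 B B>0 ε ε>0 = ℚ.positive⁻¹ _
      {{ℚ.pos*pos⇒pos (1/pos B B>0) {{ℚ.1/pos⇒pos B {{positive B>0}}}} ε {{positive ε>0}}}}

    B*scale : ∀ B (B>0 : 0ℚ < B) ε → B * scale B B>0 ε ≡ ε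
    B*scale B B>0 ε = begin
      B * (1/pos B B>0 * ε) ≡⟨ ℚ.*-assoc B (1/pos B B>0) ε ⟨
      B * 1/pos B B>0 * ε   ≡⟨ cong (_* ε) (ℚ.*-inverseʳ B {{ℚ.pos⇒nonZero B {{positive B>0}}}}) ⟩
      1ℚ * ε                ≡⟨ ℚ.*-identityˡ ε ⟩
      ε                     ∎
      where open ≡.≡-Reasoning

    ∣*∣<ε : ∀ {B} (B>0 : 0ℚ < B) {ε} a b → ∣ a ∣ < B → ∣ b ∣ < scale B B>0 ε → ∣ a * b ∣ < ε
    ∣*∣<ε {B} B>0 {ε} a b p r = begin-strict
      ∣ a * b ∣            ≡⟨ ℚ.∣p*q∣≡∣p∣*∣q∣ a b ⟩
      ∣ a ∣ * ∣ b ∣        ≤⟨ ℚ.*-monoʳ-≤-nonNeg ∣ b ∣ {{ℚ.nonNegative (ℚ.0≤∣p∣ b)}} (ℚ.<⇒≤ p) ⟩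
      B * ∣ b ∣            <⟨ ℚ.*-monoʳ-<-pos B {{positive B>0}} r ⟩
      B * scale B B>0 ε    ≡⟨ B*scale B B>0 ε ⟩
      ε                    ∎
      where open ℚ.≤-Reasoning

    bound : ∀ (x : ℝ) → ∃[ B ] 0ℚ < B × ∃[ N ] ∀ n → N ℕ.≤ n → ∣ seq x n ∣ < B
    bound x with N , close ← cauchy x 1ℚ (ℚ.positive⁻¹ 1ℚ) =
      1ℚ + ∣ seq x N ∣ ,
      ℚ.<-≤-trans (ℚ.positive⁻¹ 1ℚ) (ℚ.≤-trans (ℚ.≤-reflexive (≡.sym (ℚ.+-identityʳ 1ℚ)))
        (ℚ.+-monoʳ-≤ 1ℚ (ℚ.0≤∣p∣ (seq x N)))) ,
      N , λ n N≤n → begin-strict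
        ∣ seq x n ∣                             ≡⟨ cong ∣_∣ (split (seq x n) (seq x N)) ⟩
        ∣ (seq x n - seq x N) + seq x N ∣       ≤⟨ ℚ.∣p+q∣≤∣p∣+∣q∣ (seq x n - seq x N) (seq x N) ⟩
        ∣ seq x n - seq x N ∣ + ∣ seq x N ∣     <⟨ ℚ.+-monoˡ-< ∣ seq x N ∣ (close n N N≤n ℕ.≤-refl) ⟩
        1ℚ + ∣ seq x N ∣                        ∎
      where
      open ℚ.≤-Reasoning
      split : ∀ a b → a ≡ (a - b) + b
      split = solve 2 (λ a b → a := (a :- b) :+ b) ≡.refl
        where open +-*-Solver

    sum-difference : ∀ a b c d → (a + b) - (c + d) ≡ (a - c) + (b - d)
    sum-difference = solve 4 (λ a b c d → (a :+ b) :- (c :+ d) := (a :- c) :+ (b :- d)) ≡.refl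
      where open +-*-Solver

    product-difference : ∀ a b c d → a * b - c * d ≡ a * (b - d) + d * (a - c)
    product-difference = solve 4 (λ a b c d →
      a :* b :- c :* d := a :* (b :- d) :+ d :* (a :- c)) ≡.refl
      where open +-*-Solver

    neg-difference : ∀ a b → ∣ (- a) - (- b) ∣ ≡ ∣ a - b ∣
    neg-difference a b = ≡.trans (cong ∣_∣ (solve 2 (λ a b →
      (:- a) :- (:- b) := :- (a :- b)) ≡.refl a b)) (ℚ.∣-p∣≡∣p∣ (a - b))
      where open +-*-Solver

    ⊔ˡ : ∀ {m n k} → m ⊔ n ℕ.≤ k → m ℕ.≤ k
    ⊔ˡ {m} {n} = ℕ.≤-trans (ℕ.m≤m⊔n m n)

    ⊔ʳ : ∀ {m n k} → m ⊔ n ℕ.≤ k → n ℕ.≤ k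
    ⊔ʳ {m} {n} = ℕ.≤-trans (ℕ.m≤n⊔m m n)

    abstract

      const-cauchy : ∀ r → Cauchy λ _ → r
      const-cauchy r ε ε>0 = 0 , λ _ _ _ _ →
        subst (_< ε) (cong ∣_∣ (≡.sym (ℚ.+-inverseʳ r))) ε>0

      +-cauchy : ∀ x y → Cauchy λ n → seq x n + seq y n
      +-cauchy x y ε ε>0 =
        let (N₁ , p) = cauchy x (½ * ε) (half ε ε>0)
            (N₂ , r) = cauchy y (½ * ε) (half ε ε>0)
        in N₁ ⊔ N₂ , λ m n N≤m N≤n →
          subst (λ z → ∣ z ∣ < ε) (≡.sym (sum-difference (seq x m) (seq y m) (seq x n) (seq y n)))
            (∣+∣<ε (seq x m - seq x n) (seq y m - seq y n)
              (p m n (⊔ˡ N≤m) (⊔ˡ N≤n)) (r m n (⊔ʳ {N₁} N≤m) (⊔ʳ {N₁} N≤n)))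

      neg-cauchy : ∀ x → Cauchy λ n → - seq x n
      neg-cauchy x ε ε>0 =
        let (N , p) = cauchy x ε ε>0
        in N , λ m n N≤m N≤n →
          subst (_< ε) (≡.sym (neg-difference (seq x m) (seq x n))) (p m n N≤m N≤n)

      *-cauchy : ∀ x y → Cauchy λ n → seq x n * seq y n
      *-cauchy x y ε ε>0 =
        let (B , B>0 , N₁ , x<B) = bound x
            (C , C>0 , N₂ , y<C) = bound y
            (N₃ , p) = cauchy y (scale B B>0 (½ * ε)) (scale>0 B B>0 (½ * ε) (half ε ε>0))
            (N₄ , r) = cauchy x (scale C C>0 (½ * ε)) (scale>0 C C>0 (½ * ε) (half ε ε>0))
        in (N₁ ⊔ N₂) ⊔ (N₃ ⊔ N₄) , λ m n N≤m N≤n →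
          subst (λ z → ∣ z ∣ < ε) (≡.sym (product-difference (seq x m) (seq y m) (seq x n) (seq y n)))
            (∣+∣<ε (seq x m * (seq y m - seq y n)) (seq y n * (seq x m - seq x n))
              (∣*∣<ε B>0 (seq x m) (seq y m - seq y n) (x<B m (⊔ˡ (⊔ˡ N≤m)))
                (p m n (⊔ˡ (⊔ʳ {N₁ ⊔ N₂} N≤m)) (⊔ˡ (⊔ʳ {N₁ ⊔ N₂} N≤n))))
              (∣*∣<ε C>0 (seq y n) (seq x m - seq x n) (y<C n (⊔ʳ {N₁} (⊔ˡ N≤n)))
                (r m n (⊔ʳ {N₃} (⊔ʳ {N₁ ⊔ N₂} N≤m)) (⊔ʳ {N₃} (⊔ʳ {N₁ ⊔ N₂} N≤n)))))

  ι : ℚ → ℝ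
  ι r = (λ _ → r) , const-cauchy r

  infixl 6 _+ᴿ_
  infixl 7 _*ᴿ_
  infix  8 -ᴿ_

  _+ᴿ_ _*ᴿ_ : ℝ → ℝ → ℝ
  x +ᴿ y = (λ n → seq x n + seq y n) , +-cauchy x y
  x *ᴿ y = (λ n → seq x n * seq y n) , *-cauchy x y

  -ᴿ_ : ℝ → ℝ
  -ᴿ x = (λ n → - seq x n) , neg-cauchy x

  pointwise : ∀ {x y} → (∀ n → seq x n ≡ seq y n) → x ≈ y
  pointwise {x} {y} eq = mk≈ λ ε ε>0 → 0 , λ n _ →
    subst (_< ε) (cong ∣_∣ (≡.sym (≡.trans (cong (_- seq y n) (eq n)) (ℚ.+-inverseʳ (seq y n))))) ε>0

  private

    ≈-sym : ∀ {x y} → x ≈ y → y ≈ x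
    ≈-sym {x} {y} x≈y = mk≈ λ ε ε>0 →
      let (N , p) = null x≈y ε ε>0
      in N , λ n N≤n → subst (_< ε)
        (≡.trans (≡.sym (ℚ.∣-p∣≡∣p∣ _)) (cong ∣_∣ (swap (seq x n) (seq y n)))) (p n N≤n)
      where
      swap : ∀ a b → - (a - b) ≡ b - a
      swap = solve 2 (λ a b → :- (a :- b) := b :- a) ≡.refl
        where open +-*-Solver

    ≈-trans : ∀ {x y z} → x ≈ y → y ≈ z → x ≈ z
    ≈-trans {x} {y} {z} x≈y y≈z = mk≈ λ ε ε>0 →
      let (N₁ , p) = null x≈y (½ * ε) (half ε ε>0)
          (N₂ , r) = null y≈z (½ * ε) (half ε ε>0)
      in N₁ ⊔ N₂ , λ n N≤n → subst (λ w → ∣ w ∣ < ε) (join (seq x n) (seq y n) (seq z n))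
        (∣+∣<ε _ _ (p n (⊔ˡ N≤n)) (r n (⊔ʳ {N₁} N≤n)))
      where
      join : ∀ a b c → (a - b) + (b - c) ≡ a - c
      join = solve 3 (λ a b c → (a :- b) :+ (b :- c) := a :- c) ≡.refl
        where open +-*-Solver

    +-cong : ∀ {x x′ y y′} → x ≈ x′ → y ≈ y′ → x +ᴿ y ≈ x′ +ᴿ y′
    +-cong {x} {x′} {y} {y′} x≈x′ y≈y′ = mk≈ λ ε ε>0 →
      let (N₁ , p) = null x≈x′ (½ * ε) (half ε ε>0)
          (N₂ , r) = null y≈y′ (½ * ε) (half ε ε>0)
      in N₁ ⊔ N₂ , λ n N≤n →
        subst (λ z → ∣ z ∣ < ε) (≡.sym (sum-difference (seq x n) (seq y n) (seq x′ n) (seq y′ n)))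
          (∣+∣<ε _ _ (p n (⊔ˡ N≤n)) (r n (⊔ʳ {N₁} N≤n)))

    neg-cong : ∀ {x x′} → x ≈ x′ → -ᴿ x ≈ -ᴿ x′
    neg-cong {x} {x′} x≈x′ = mk≈ λ ε ε>0 →
      let (N , p) = null x≈x′ ε ε>0
      in N , λ n N≤n → subst (_< ε) (≡.sym (neg-difference (seq x n) (seq x′ n))) (p n N≤n)

    *-cong : ∀ {x x′ y y′} → x ≈ x′ → y ≈ y′ → x *ᴿ y ≈ x′ *ᴿ y′
    *-cong {x} {x′} {y} {y′} x≈x′ y≈y′ = mk≈ λ ε ε>0 →
      let (B , B>0 , N₁ , x<B) = bound x
          (C , C>0 , N₂ , y<C) = bound y′
          (N₃ , p) = null y≈y′ _ (scale>0 B B>0 (½ * ε) (half ε ε>0))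
          (N₄ , r) = null x≈x′ _ (scale>0 C C>0 (½ * ε) (half ε ε>0))
      in (N₁ ⊔ N₂) ⊔ (N₃ ⊔ N₄) , λ n N≤n →
        subst (λ z → ∣ z ∣ < ε) (≡.sym (product-difference (seq x n) (seq y n) (seq x′ n) (seq y′ n)))
          (∣+∣<ε _ _
            (∣*∣<ε B>0 (seq x n) _ (x<B n (⊔ˡ (⊔ˡ N≤n))) (p n (⊔ˡ (⊔ʳ {N₁ ⊔ N₂} N≤n))))
            (∣*∣<ε C>0 (seq y′ n) _ (y<C n (⊔ʳ {N₁} (⊔ˡ N≤n))) (r n (⊔ʳ {N₃} (⊔ʳ {N₁ ⊔ N₂} N≤n)))))

    open import Algebra.Definitions _≈_

    isEquivalence : IsEquivalence _≈_
    isEquivalence = record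
      { refl  = λ {x} → pointwise {x} {x} λ _ → ≡.refl
      ; sym   = ≈-sym
      ; trans = ≈-trans
      }

    +-assoc : Associative _+ᴿ_
    +-assoc x y z = pointwise {(x +ᴿ y) +ᴿ z} {x +ᴿ (y +ᴿ z)}
      λ n → ℚ.+-assoc (seq x n) (seq y n) (seq z n)

    +-comm : Commutative _+ᴿ_
    +-comm x y = pointwise {x +ᴿ y} {y +ᴿ x} λ n → ℚ.+-comm (seq x n) (seq y n)

    +-identityˡ : LeftIdentity (ι 0ℚ) _+ᴿ_
    +-identityˡ x = pointwise {(ι 0ℚ) +ᴿ x} {x} λ n → ℚ.+-identityˡ (seq x n)

    +-inverseˡ : LeftInverse (ι 0ℚ) -ᴿ_ _+ᴿ_
    +-inverseˡ x = pointwise { -ᴿ x +ᴿ x} {ι 0ℚ} λ n → ℚ.+-inverseˡ (seq x n)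

    *-assoc : Associative _*ᴿ_
    *-assoc x y z = pointwise {(x *ᴿ y) *ᴿ z} {x *ᴿ (y *ᴿ z)}
      λ n → ℚ.*-assoc (seq x n) (seq y n) (seq z n)

    *-comm : Commutative _*ᴿ_
    *-comm x y = pointwise {x *ᴿ y} {y *ᴿ x} λ n → ℚ.*-comm (seq x n) (seq y n)

    *-identityˡ : LeftIdentity (ι 1ℚ) _*ᴿ_
    *-identityˡ x = pointwise {(ι 1ℚ) *ᴿ x} {x} λ n → ℚ.*-identityˡ (seq x n)

    *-distribˡ-+ : _*ᴿ_ DistributesOverˡ _+ᴿ_
    *-distribˡ-+ x y z = pointwise {x *ᴿ (y +ᴿ z)} {x *ᴿ y +ᴿ x *ᴿ z}
      λ n → ℚ.*-distribˡ-+ (seq x n) (seq y n) (seq z n)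

  isCommutativeRing : IsCommutativeRing _≈_ _+ᴿ_ _*ᴿ_ -ᴿ_ (ι 0ℚ) (ι 1ℚ)
  isCommutativeRing = mkIsCommutativeRing isEquivalence +-cong neg-cong *-cong
    +-assoc +-comm +-identityˡ +-inverseˡ *-assoc *-comm *-identityˡ *-distribˡ-+

ℝ-commutativeRing : CommutativeRing 0ℓ 0ℓ
ℝ-commutativeRing = record { isCommutativeRing = Real.isCommutativeRing }

module AdjoinI (R : CommutativeRing 0ℓ 0ℓ) where

  private
    module Identities where

      open CommutativeRing R
      open Algebra.Solver.Ring.NaturalCoefficients.Default commutativeSemiring

      assoc-re : ∀ s a b c d e f →
        (a * c + s * (b * d)) * e + s * ((a * d + b * c) * f) ≈
        a * (c * e + s * (d * f)) + s * (b * (c * f + d * e))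
      assoc-re = solve 7 (λ s a b c d e f →
        (a :* c :+ s :* (b :* d)) :* e :+ s :* ((a :* d :+ b :* c) :* f) := a :* (c :* e :+ s :* (d :* f)) :+ s :* (b :* (c :* f :+ d :* e))) refl

      assoc-im : ∀ s a b c d e f →
        (a * c + s * (b * d)) * f + (a * d + b * c) * e ≈
        a * (c * f + d * e) + b * (c * e + s * (d * f))
      assoc-im = solve 7 (λ s a b c d e f →
        (a :* c :+ s :* (b :* d)) :* f :+ (a :* d :+ b :* c) :* e := a :* (c :* f :+ d :* e) :+ b :* (c :* e :+ s :* (d :* f))) refl

      comm-im : ∀ a b c d → a * d + b * c ≈ c * b + d * a
      comm-im = solve 4 (λ a b c d →
        a :* d :+ b :* c := c :* b :+ d :* a) refl

      distrib-re : ∀ s a b c d e f →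
        a * (c + e) + s * (b * (d + f)) ≈ (a * c + s * (b * d)) + (a * e + s * (b * f))
      distrib-re = solve 7 (λ s a b c d e f →
        a :* (c :+ e) :+ s :* (b :* (d :+ f)) := (a :* c :+ s :* (b :* d)) :+ (a :* e :+ s :* (b :* f))) refl

      distrib-im : ∀ a b c d e f →
        a * (d + f) + b * (c + e) ≈ (a * d + b * c) + (a * f + b * e)
      distrib-im = solve 6 (λ a b c d e f →
        a :* (d :+ f) :+ b :* (c :+ e) := (a :* d :+ b :* c) :+ (a :* f :+ b :* e)) refl

  open CommutativeRing R hiding (ring; isCommutativeRing)

  infix 5 _+i_
  record Complex : Set where
    constructor _+i_
    field
      re im : Carrier

  open Complex public

  infix 4 _≈ᶜ_
  record _≈ᶜ_ (z w : Complex) : Set where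
    constructor _,_
    field
      re≈ : re z ≈ re w
      im≈ : im z ≈ im w

  open _≈ᶜ_ public

  infixl 6 _+ᶜ_
  infixl 7 _*ᶜ_
  infix  8 -ᶜ_

  _+ᶜ_ _*ᶜ_ : Complex → Complex → Complex
  (a +i b) +ᶜ (c +i d) = (a + c) +i (b + d)
  (a +i b) *ᶜ (c +i d) = (a * c - b * d) +i (a * d + b * c)

  -ᶜ_ : Complex → Complex
  -ᶜ (a +i b) = (- a) +i (- b)

  private

    open Algebra.Properties.Ring (CommutativeRing.ring R) using (-0#≈0#; -1*x≈-x)

    minus : ∀ x y → x - y ≈ x + (- 1#) * y
    minus x y = +-congˡ (sym (-1*x≈-x y))

    *-assoc-re : ∀ a b c d e f →
      (a * c - b * d) * e - (a * d + b * c) * f ≈ a * (c * e - d * f) - b * (c * f + d * e)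
    *-assoc-re a b c d e f =
      trans (trans (minus _ _) (+-congʳ (*-congʳ (minus _ _))))
        (trans (Identities.assoc-re (- 1#) a b c d e f)
          (sym (trans (minus _ _) (+-congʳ (*-congˡ (minus _ _))))))

    *-assoc-im : ∀ a b c d e f →
      (a * c - b * d) * f + (a * d + b * c) * e ≈ a * (c * f + d * e) + b * (c * e - d * f)
    *-assoc-im a b c d e f =
      trans (+-congʳ (*-congʳ (minus _ _)))
        (trans (Identities.assoc-im (- 1#) a b c d e f)
          (sym (+-congˡ (*-congˡ (minus _ _)))))

    *-comm-re : ∀ a b c d → a * c - b * d ≈ c * a - d * b
    *-comm-re a b c d = +-cong (*-comm a c) (-‿cong (*-comm b d))

    distrib-re : ∀ a b c d e f →
      a * (c + e) - b * (d + f) ≈ (a * c - b * d) + (a * e - b * f)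
    distrib-re a b c d e f =
      trans (minus _ _)
        (trans (Identities.distrib-re (- 1#) a b c d e f)
          (sym (+-cong (minus _ _) (minus _ _))))

    identity-re : ∀ a b → 1# * a - 0# * b ≈ a
    identity-re a b = begin
      1# * a - 0# * b  ≈⟨ +-cong (*-identityˡ a) (-‿cong (zeroˡ b)) ⟩
      a - 0#           ≈⟨ +-congˡ -0#≈0# ⟩
      a + 0#           ≈⟨ +-identityʳ a ⟩
      a                ∎
      where
      open ≈-Reasoning setoid

    identity-im : ∀ a b → 1# * b + 0# * a ≈ b
    identity-im a b = trans (+-cong (*-identityˡ b) (zeroˡ a)) (+-identityʳ b)

  commutativeRing : CommutativeRing 0ℓ 0ℓ
  commutativeRing = record
    { _≈_ = _≈ᶜ_
    ; isCommutativeRing = mkIsCommutativeRing { -_ = -ᶜ_} {0# +i 0#} {1# +i 0#}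
        (record
          { refl  = refl , refl
          ; sym   = λ (p , r) → sym p , sym r
          ; trans = λ (p , r) (p′ , r′) → trans p p′ , trans r r′
          })
        (λ (p , r) (p′ , r′) → +-cong p p′ , +-cong r r′)
        (λ (p , r) → -‿cong p , -‿cong r)
        (λ (p , r) (p′ , r′) →
          +-cong (*-cong p p′) (-‿cong (*-cong r r′)) , +-cong (*-cong p r′) (*-cong r p′))
        (λ (a +i b) (c +i d) (e +i f) → +-assoc a c e , +-assoc b d f)
        (λ (a +i b) (c +i d) → +-comm a c , +-comm b d)
        (λ (a +i b) → +-identityˡ a , +-identityˡ b)
        (λ (a +i b) → -‿inverseˡ a , -‿inverseˡ b)
        (λ (a +i b) (c +i d) (e +i f) → *-assoc-re a b c d e f , *-assoc-im a b c d e f)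
        (λ (a +i b) (c +i d) → *-comm-re a b c d , Identities.comm-im a b c d)
        (λ (a +i b) → identity-re a b , identity-im a b)
        (λ (a +i b) (c +i d) (e +i f) → distrib-re a b c d e f , Identities.distrib-im a b c d e f)
    }

ℂ-commutativeRing : CommutativeRing 0ℓ 0ℓ
ℂ-commutativeRing = AdjoinI.commutativeRing ℝ-commutativeRing

module ℂ = CommutativeRing ℂ-commutativeRing

fromℚ : ℚ → ℂ.Carrier
fromℚ r = Real.ι r AdjoinI.+i Real.ι 0ℚ

record FiniteField c ℓ₁ ℓ₂ (q : ℕ) : Set (lsuc (c ⊔ˡ ℓ₁ ⊔ˡ ℓ₂)) where
  field
    heytingField : HeytingField c ℓ₁ ℓ₂

  open HeytingField heytingField public
  open HeytingCommutativeRing heytingCommutativeRing public using (commutativeRing)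
  open CommutativeRing commutativeRing public using (+-group)

  -- A Heyting field may be the zero ring, so this has to be asked for.
  field
    0≉1         : ¬ 0# ≈ 1#
    enumeration : Inverse setoid (≡.setoid (Fin q))

module VectorSpace
  {c ℓ₁ ℓ₂ m ℓm} {q : ℕ} (F : FiniteField c ℓ₁ ℓ₂ q)
  (H : Module (FiniteField.commutativeRing F) m ℓm) where

  open FiniteField F hiding (zero) renaming (Carrier to 𝔽)
  open Module H
  open Algebra.Properties.CommutativeMonoid.Sum +ᴹ-commutativeMonoid
    using (sum; sum-cong-≋; ∑-distrib-+)

  linearCombination : ∀ {k} → Vector 𝔽 k → Vector Carrierᴹ k → Carrierᴹ
  linearCombination a v = sum λ i → a i *ₗ v i

  LinearlyIndependent : ∀ {k} → Vector Carrierᴹ k → Set _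
  LinearlyIndependent v = ∀ a → linearCombination a v ≈ᴹ 0ᴹ → ∀ i → a i ≈ 0#

  _∈span_ : ∀ {k} → Carrierᴹ → Vector Carrierᴹ k → Set _
  x ∈span v = ∃[ a ] x ≈ᴹ linearCombination a v

  record IsBasis {p} (P : Pred Carrierᴹ p) {k} (v : Vector Carrierᴹ k) : Set (c ⊔ˡ ℓ₁ ⊔ˡ m ⊔ˡ ℓm ⊔ˡ p) where
    field
      contained   : ∀ i → P (v i)
      independent : LinearlyIndependent v
      spanning    : ∀ x → P x → x ∈span v

  HasDimension : ∀ {p} → Pred Carrierᴹ p → ℕ → Set _
  HasDimension P k = ∃[ v ] IsBasis P {k} v

  q-nonZero : NonZero q
  q-nonZero = Fin.nonZeroIndex (Inverse.to enumeration 0#)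

  private
    module E = Inverse enumeration

    _≈?_ : ∀ x y → Dec (x ≈ y)
    x ≈? y = map′
      (λ eq → trans (sym (E.strictlyInverseʳ x)) (trans (E.from-cong eq) (E.strictlyInverseʳ y)))
      E.to-cong (E.to x Fin.≟ E.to y)

    invert : ∀ {x} → ¬ x ≈ 0# → ∃[ y ] y * x ≈ 1#
    invert {x} x≉0 with Fin.any? (λ i → (E.from i * x) ≈? 1#)
    ... | yes (i , eq) = E.from i , eq
    ... | no  none     = contradiction (proj₁ (tight x 0#) λ x#0 →
      let (y , yx≈1 , _) = #⇒invertible x#0
      in none (E.to y , trans (*-cong (E.strictlyInverseʳ y) (sym x-0≈x)) yx≈1)) x≉0
      where
      open Algebra.Properties.Group +-group using (ε⁻¹≈ε)
      x-0≈x : x - 0# ≈ x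
      x-0≈x = trans (+-congˡ ε⁻¹≈ε) (+-identityʳ x)

    lc : ∀ {k} → Vector 𝔽 k → Vector Carrierᴹ k → Carrierᴹ
    lc = linearCombination

    lc-cong : ∀ {k} {a b : Vector 𝔽 k} v → (∀ i → a i ≈ b i) → lc a v ≈ᴹ lc b v
    lc-cong v eq = sum-cong-≋ λ i → *ₗ-cong (eq i) ≈ᴹ-refl

    lc-+ : ∀ {k} (a b : Vector 𝔽 k) v → lc (λ i → a i + b i) v ≈ᴹ lc a v +ᴹ lc b v
    lc-+ a b v = ≈ᴹ-trans (sum-cong-≋ λ i → *ₗ-distribʳ (v i) (a i) (b i))
      (∑-distrib-+ (λ i → a i *ₗ v i) λ i → b i *ₗ v i)

    lc-* : ∀ {k} r (a : Vector 𝔽 k) v → r *ₗ lc a v ≈ᴹ lc (λ i → r * a i) v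
    lc-* {zero}  r a v = *ₗ-zeroʳ r
    lc-* {suc k} r a v = ≈ᴹ-trans (*ₗ-distribˡ r _ _)
      (+ᴹ-cong (≈ᴹ-sym (*ₗ-assoc r _ _)) (lc-* r (a ∘ suc) (v ∘ suc)))

    lc-0 : ∀ {k} (v : Vector Carrierᴹ k) → lc (λ _ → 0#) v ≈ᴹ 0ᴹ
    lc-0 {zero}  v = ≈ᴹ-refl
    lc-0 {suc k} v = ≈ᴹ-trans (+ᴹ-cong (*ₗ-zeroˡ _) (lc-0 (v ∘ suc))) (+ᴹ-identityˡ 0ᴹ)

    cancel : ∀ a b → (a - b) + b ≈ a
    cancel a b = trans (+-assoc a (- b) b) (trans (+-congˡ (-‿inverseˡ b)) (+-identityʳ a))

    coefficients-unique : ∀ {k} {v : Vector Carrierᴹ k} → LinearlyIndependent v →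
      ∀ a b → lc a v ≈ᴹ lc b v → ∀ i → a i ≈ b i
    coefficients-unique {v = v} indep a b eq i =
      trans (sym (cancel (a i) (b i))) (trans (+-congʳ (indep _ diff i)) (+-identityˡ (b i)))
      where
      open Algebra.Properties.Group +ᴹ-group using (identityˡ-unique)
      diff : lc (λ j → a j - b j) v ≈ᴹ 0ᴹ
      diff = identityˡ-unique _ (lc b v)
        (≈ᴹ-trans (≈ᴹ-sym (lc-+ _ b v)) (≈ᴹ-trans (lc-cong v λ j → cancel (a j) (b j)) eq))

    δ : ∀ {k} → Fin k → Vector 𝔽 k
    δ zero    zero    = 1#
    δ zero    (suc j) = 0#
    δ (suc i) zero    = 0#
    δ (suc i) (suc j) = δ i j

    δ-diagonal : ∀ {k} (i : Fin k) → δ i i ≈ 1#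
    δ-diagonal zero    = refl
    δ-diagonal (suc i) = δ-diagonal i

    δ-off : ∀ {k} {i j : Fin k} → i ≢ j → δ i j ≈ 0#
    δ-off {i = zero}  {zero}  i≢j = contradiction ≡.refl i≢j
    δ-off {i = zero}  {suc j} i≢j = refl
    δ-off {i = suc i} {zero}  i≢j = refl
    δ-off {i = suc i} {suc j} i≢j = δ-off (i≢j ∘ cong suc)

    lc-δ : ∀ {k} i (v : Vector Carrierᴹ k) → lc (δ i) v ≈ᴹ v i
    lc-δ zero    v = ≈ᴹ-trans (+ᴹ-cong (*ₗ-identityˡ _) (lc-0 (v ∘ suc))) (+ᴹ-identityʳ _)
    lc-δ (suc i) v = ≈ᴹ-trans (+ᴹ-cong (*ₗ-zeroˡ _) (lc-δ i (v ∘ suc))) (+ᴹ-identityˡ _)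

    independent⇒distinct : ∀ {k} {v : Vector Carrierᴹ k} → LinearlyIndependent v →
      ∀ {i j} → i ≢ j → ¬ v i ≈ᴹ v j
    independent⇒distinct {v = v} indep {i} {j} i≢j vᵢ≈vⱼ = 0≉1
      (trans (sym (δ-off (i≢j ∘ ≡.sym))) (trans (sym
        (coefficients-unique indep (δ i) (δ j) (≈ᴹ-trans (lc-δ i v) (≈ᴹ-trans vᵢ≈vⱼ (≈ᴹ-sym (lc-δ j v)))) i))
        (δ-diagonal i)))

    extend-independent : ∀ {k} {v : Vector Carrierᴹ k} {x} → LinearlyIndependent v →
      ¬ x ∈span v → LinearlyIndependent (x ◂ v)
    extend-independent {k} {v} {x} indep x∉ a eq with a zero ≈? 0#
    ... | yes a₀≈0 = λ { zero → a₀≈0 ; (suc i) → indep (a ∘ suc) rest i }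
      where
      rest : lc (a ∘ suc) v ≈ᴹ 0ᴹ
      rest = ≈ᴹ-trans (≈ᴹ-sym (+ᴹ-identityˡ _))
        (≈ᴹ-trans (+ᴹ-congʳ (≈ᴹ-sym (≈ᴹ-trans (*ₗ-cong a₀≈0 ≈ᴹ-refl) (*ₗ-zeroˡ x)))) eq)
    ... | no a₀≉0 with b , ba₀≈1 ← invert a₀≉0 = contradiction (_ , x≈) x∉
      where
      open Algebra.Properties.Group +ᴹ-group using (inverseˡ-unique; ⁻¹-anti-homo-∙)
      open ≈-Reasoning ≈ᴹ-setoid
      negate : ∀ {k} (a : Vector 𝔽 k) v → -ᴹ lc a v ≈ᴹ lc (λ i → - a i) v
      negate a v = ≈ᴹ-sym (inverseˡ-unique _ _ (≈ᴹ-trans (≈ᴹ-sym (lc-+ _ a v))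
        (≈ᴹ-trans (lc-cong v λ i → -‿inverseˡ (a i)) (lc-0 v))))
      x≈ : x ≈ᴹ lc (λ i → b * - a (suc i)) v
      x≈ = begin
        x                             ≈⟨ *ₗ-identityˡ x ⟨
        1# *ₗ x                       ≈⟨ *ₗ-cong ba₀≈1 ≈ᴹ-refl ⟨
        (b * a zero) *ₗ x             ≈⟨ *ₗ-assoc b (a zero) x ⟩
        b *ₗ a zero *ₗ x              ≈⟨ *ₗ-cong refl (inverseˡ-unique _ _ eq) ⟩
        b *ₗ -ᴹ lc (a ∘ suc) v        ≈⟨ *ₗ-cong refl (negate (a ∘ suc) v) ⟩
        b *ₗ lc (λ i → - a (suc i)) v ≈⟨ lc-* b _ v ⟩
        lc (λ i → b * - a (suc i)) v  ∎

  module Finite {d : ℕ} (basis : HasDimension U d) where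

    open IsBasis (proj₂ basis)

    ∣H∣ : ℕ
    ∣H∣ = q ℕ.^ d

    coordinates : Carrierᴹ → Vector 𝔽 d
    coordinates x = proj₁ (spanning x _)

    index : Carrierᴹ → Fin ∣H∣
    index x = funToFin (E.to ∘ coordinates x)

    vector : Fin ∣H∣ → Carrierᴹ
    vector i = linearCombination (E.from ∘ finToFun i) (proj₁ basis)

    vector-index : ∀ x → vector (index x) ≈ᴹ x
    vector-index x = ≈ᴹ-trans
      (lc-cong _ λ i → trans (E.from-cong (Fin.finToFun-funToFin (E.to ∘ coordinates x) i)) (E.strictlyInverseʳ _))
      (≈ᴹ-sym (proj₂ (spanning x _)))

    private
      funToFin-cong : ∀ {k n} {f g : Fin k → Fin n} → (∀ i → f i ≡ g i) → funToFin f ≡ funToFin g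
      funToFin-cong {zero}  eq = ≡.refl
      funToFin-cong {suc k} eq rewrite eq zero | funToFin-cong (eq ∘ suc) = ≡.refl

    index-cong : ∀ {x y} → x ≈ᴹ y → index x ≡ index y
    index-cong {x} {y} x≈y = funToFin-cong λ i → E.to-cong
      (coefficients-unique independent (coordinates x) (coordinates y)
        (≈ᴹ-trans (≈ᴹ-sym (proj₂ (spanning x _))) (≈ᴹ-trans x≈y (proj₂ (spanning y _)))) i)

    index-vector : ∀ i → index (vector i) ≡ i
    index-vector i = ≡.trans (funToFin-cong λ j → ≡.trans (E.to-cong
      (coefficients-unique independent (coordinates (vector i)) (E.from ∘ finToFun i)
        (≈ᴹ-sym (proj₂ (spanning (vector i) _))) j)) (E.strictlyInverseˡ _))
      (Fin.funToFin-finToFin {d} {q} i)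

    -- Sets of vectors are bit vectors over the q ^ d coordinate tuples, so that
    -- they have propositional equality and can be listed.
    infix 4 _∈ᴴ_

    _∈ᴴ_ : Carrierᴹ → Subset ∣H∣ → Set
    x ∈ᴴ y = index x ∈ y

    record IsSubspace (y : Subset ∣H∣) : Set (c ⊔ˡ m) where
      field
        0-closed : 0ᴹ ∈ᴴ y
        +-closed : ∀ u v → u ∈ᴴ y → v ∈ᴴ y → u +ᴹ v ∈ᴴ y
        *-closed : ∀ a v → v ∈ᴴ y → a *ₗ v ∈ᴴ y

    private

      resp : ∀ {y u v} → u ≈ᴹ v → u ∈ᴴ y → v ∈ᴴ y
      resp {y} u≈v = subst (_∈ y) (index-cong u≈v)

      all-vectors? : ∀ {p} {P : Pred Carrierᴹ p} → (∀ {u v} → u ≈ᴹ v → P u → P v) →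
        Decidable P → Dec (∀ v → P v)
      all-vectors? P-resp P? = map′ (λ all v → P-resp (vector-index v) (all (index v))) (_∘ vector)
        (Fin.all? (P? ∘ vector))

      all-scalars? : ∀ {p} {P : Pred 𝔽 p} → (∀ {a b} → a ≈ b → P a → P b) →
        Decidable P → Dec (∀ a → P a)
      all-scalars? P-resp P? = map′ (λ all a → P-resp (E.strictlyInverseʳ a) (all (E.to a))) (_∘ E.from)
        (Fin.all? (P? ∘ E.from))

      _≈ᴹ?_ : ∀ u v → Dec (u ≈ᴹ v)
      u ≈ᴹ? v = map′
        (λ eq → ≈ᴹ-trans (≈ᴹ-sym (vector-index u))
          (≈ᴹ-trans (≈ᴹ-reflexive (cong vector eq)) (vector-index v)))
        index-cong (index u Fin.≟ index v)

    abstract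

      isSubspace? : Decidable IsSubspace
      isSubspace? y = map′
        (λ (z , a , s) → record { 0-closed = z ; +-closed = a ; *-closed = s })
        (λ y-sub → let open IsSubspace y-sub in 0-closed , +-closed , *-closed)
        ((index 0ᴹ ∈? y) ×-dec
         all-vectors? (λ u≈u′ h v u′∈ v∈ →
             resp (+ᴹ-cong u≈u′ ≈ᴹ-refl) (h v (resp (≈ᴹ-sym u≈u′) u′∈) v∈))
           (λ u → all-vectors? (λ v≈v′ h u∈ v′∈ →
               resp (+ᴹ-cong ≈ᴹ-refl v≈v′) (h u∈ (resp (≈ᴹ-sym v≈v′) v′∈)))
             λ v → (index u ∈? y) →-dec (index v ∈? y) →-dec (index (u +ᴹ v) ∈? y)) ×-dec
         all-scalars? (λ a≈b h v v∈ → resp (*ₗ-cong a≈b ≈ᴹ-refl) (h v v∈))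
           (λ a → all-vectors? (λ v≈v′ h v′∈ →
               resp (*ₗ-cong refl v≈v′) (h (resp (≈ᴹ-sym v≈v′) v′∈)))
             λ v → (index v ∈? y) →-dec (index (a *ₗ v) ∈? y)))

    private

      _∈span?_ : ∀ {k} x (v : Vector Carrierᴹ k) → Dec (x ∈span v)
      _∈span?_ {k} x v = map′
        (λ (i , eq) → _ , eq)
        (λ (a , eq) → funToFin (E.to ∘ a) , ≈ᴹ-trans eq (lc-cong v λ i → sym (trans
          (E.from-cong (Fin.finToFun-funToFin (E.to ∘ a) i)) (E.strictlyInverseʳ (a i)))))
        (Fin.any? λ (i : Fin (q ℕ.^ k)) → x ≈ᴹ? lc (E.from ∘ finToFun i) v)

      extend : ∀ (y : Subset ∣H∣) fuel {k} (v : Vector Carrierᴹ k) → fuel ℕ.+ k ≡ suc ∣H∣ →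
        (∀ i → v i ∈ᴴ y) → LinearlyIndependent v → ∃ (HasDimension (_∈ᴴ y))
      extend y zero v ≡.refl v∈ indep
        with i , j , i<j , eq ← Fin.pigeonhole ℕ.≤-refl (index ∘ v) =
        contradiction
          (≈ᴹ-trans (≈ᴹ-sym (vector-index (v i)))
            (≈ᴹ-trans (≈ᴹ-reflexive (cong vector eq)) (vector-index (v j))))
          (independent⇒distinct indep (Fin.<⇒≢ i<j))
      extend y (suc fuel) {k} v eq v∈ indep
        with Fin.any? (λ i → (i ∈? y) ×-dec ¬? (vector i ∈span? v))
      ... | yes (i , i∈ , i∉) = extend y fuel (vector i ◂ v) (≡.trans (ℕ.+-suc fuel k) eq)
        (λ { zero → subst (_∈ y) (≡.sym (index-vector i)) i∈ ; (suc j) → v∈ j })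
        (extend-independent indep i∉)
      ... | no  none = k , v , record
        { contained   = v∈
        ; independent = indep
        ; spanning    = λ x x∈ →
            let (a , eq) = decidable-stable (vector (index x) ∈span? v) (λ x∉ → none (index x , x∈ , x∉))
            in a , ≈ᴹ-trans (≈ᴹ-sym (vector-index x)) eq
        }

    TrivialIntersection : (y z : Subset ∣H∣) → Set _
    TrivialIntersection y z = ∀ v → v ∈ᴴ y → v ∈ᴴ z → v ≈ᴹ 0ᴹ

    abstract

      trivialIntersection? : ∀ y z → Dec (TrivialIntersection y z)
      trivialIntersection? y z = all-vectors?
        (λ u≈v f v∈y v∈z → ≈ᴹ-trans (≈ᴹ-sym u≈v) (f (resp (≈ᴹ-sym u≈v) v∈y) (resp (≈ᴹ-sym u≈v) v∈z)))
        (λ v → (index v ∈? y) →-dec (index v ∈? z) →-dec (v ≈ᴹ? 0ᴹ))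

      -- The greedy choice of a basis does not use that y is closed, so closure is
      -- not assumed; dim below applies this to subspaces only.
      dimension : ∀ y → ∃ (HasDimension (_∈ᴴ y))
      dimension y = extend y (suc ∣H∣) (λ ()) (ℕ.+-identityʳ (suc ∣H∣)) (λ ()) λ _ _ ()

    Subspace : Set _
    Subspace = [ y ∈ Subset ∣H∣ ∣ IsSubspace y ]

    dim : Subspace → ℕ
    dim y = proj₁ (dimension (value y))

    dim-correct : ∀ y → HasDimension (_∈ᴴ value y) (dim y)
    dim-correct y = proj₂ (dimension (value y))

private

  mapMaybe-unique : ∀ {a b} {A : Set a} {B : Set b} (f : A → Maybe B) →
    (∀ {x y z} → f x ≡ just z → f y ≡ just z → x ≡ y) →
    ∀ {xs} → Unique xs → Unique (mapMaybe f xs)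
  mapMaybe-unique f inj [] = []
  mapMaybe-unique f inj {x ∷ xs} (x∉xs ∷ unique) with f x in eq
  ... | nothing = mapMaybe-unique f inj unique
  ... | just z  = All.mapMaybe⁺ (All.map⁺ (All.map distinct x∉xs)) ∷ mapMaybe-unique f inj unique
    where
    distinct : ∀ {y} → x ≢ y → Maybe.All (z ≢_) (f y)
    distinct {y} x≢y with f y in eq′
    ... | nothing = nothing
    ... | just w  = just λ { ≡.refl → x≢y (inj eq eq′) }

module AttenuatedSpace
  {c ℓ₁ ℓ₂ m ℓm} {q : ℕ} (F : FiniteField c ℓ₁ ℓ₂ q)
  (H : Module (FiniteField.commutativeRing F) m ℓm) {d : ℕ}
  (basis : VectorSpace.HasDimension F H U d)
  (h : VectorSpace.Finite.Subspace F H basis) where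

  open VectorSpace F H
  open Finite basis

  -- The proofs inside X are irrelevant: elements of X are equal as soon as they
  -- are equal as sets of vectors.
  X : Set (c ⊔ˡ m ⊔ˡ ℓm)
  X = [ y ∈ Subspace ∣ TrivialIntersection (value y) (value h) ]

  rank : X → ℕ
  rank y = dim (value y)

  _⊑_ : X → X → Set
  y ⊑ z = value (value y) ⊆ value (value z)

  _Covers_ : X → X → Set
  z Covers y = y ⊑ z × rank z ≡ suc (rank y)

  _covers?_ : ∀ z y → Dec (z Covers y)
  z covers? y = (value (value y) ⊆? value (value z)) ×-dec (rank z ℕ.≟ suc (rank y))

  _≟_ : DecidableEquality X
  _≟_ = Refinement._≟_ (Refinement._≟_ (Vec.≡-dec Bool._≟_))

  abstract

    subsets : ∀ n → List (Subset n)
    subsets zero    = [] ∷ []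
    subsets (suc n) = List.map (outside ∷_) (subsets n) List.++ List.map (inside ∷_) (subsets n)

    fromSubset : Subset ∣H∣ → Maybe X
    fromSubset y with isSubspace? y | trivialIntersection? y (value h)
    ... | yes p | yes r = just ((y , [ p ]) , [ r ])
    ... | _     | _     = nothing

    elements : List X
    elements = mapMaybe fromSubset (subsets ∣H∣)

    subsets-complete : ∀ {n} (y : Subset n) → y ∈ˡ subsets n
    subsets-complete []            = here ≡.refl
    subsets-complete (outside ∷ y) = ∈-++⁺ˡ (∈-map⁺ (outside ∷_) (subsets-complete y))
    subsets-complete {suc n} (inside ∷ y) =
      ∈-++⁺ʳ (List.map (outside ∷_) (subsets n)) (∈-map⁺ (inside ∷_) (subsets-complete y))

    subsets-unique : ∀ n → Unique (subsets n)
    subsets-unique zero    = [] ∷ []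
    subsets-unique (suc n) = Unique.++⁺
      (Unique.map⁺ Vec.∷-injectiveʳ (subsets-unique n))
      (Unique.map⁺ Vec.∷-injectiveʳ (subsets-unique n))
      λ (y∈ , y∈′) → disjoint y∈ y∈′
      where
      disjoint : ∀ {xs ys : List (Subset n)} {y} →
        y ∈ˡ List.map (outside ∷_) xs → ¬ y ∈ˡ List.map (inside ∷_) ys
      disjoint y∈ y∈′ with ∈-map⁻ (outside ∷_) y∈ | ∈-map⁻ (inside ∷_) y∈′
      ... | _ , _ , ≡.refl | _ , _ , ()

    fromSubset-value : ∀ y {x} → fromSubset y ≡ just x → value (value x) ≡ y
    fromSubset-value y eq with isSubspace? y | trivialIntersection? y (value h)
    fromSubset-value y ≡.refl | yes _ | yes _ = ≡.refl

    fromSubset-complete : ∀ x → fromSubset (value (value x)) ≡ just x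
    fromSubset-complete ((y , [ p ]) , [ r ]) with isSubspace? y | trivialIntersection? y (value h)
    ... | yes _ | yes _ = ≡.refl
    ... | no ¬p | _     = ⊥-elim-irr (¬p p)
    ... | yes _ | no ¬r = ⊥-elim-irr (¬r r)

    fromSubset-injective : ∀ {y z x} → fromSubset y ≡ just x → fromSubset z ≡ just x → y ≡ z
    fromSubset-injective eq eq′ = ≡.trans (≡.sym (fromSubset-value _ eq)) (fromSubset-value _ eq′)

    elements-complete : ∀ x → x ∈ˡ elements
    elements-complete x = Any.mapMaybe⁺ fromSubset (subsets ∣H∣)
      (Any.map⁺ (Any.map found (subsets-complete (value (value x)))))
      where
      found : ∀ {y} → value (value x) ≡ y → Maybe.Any (x ≡_) (fromSubset y)
      found ≡.refl = subst (Maybe.Any (x ≡_)) (≡.sym (fromSubset-complete x)) (just ≡.refl)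

    elements-unique : Unique elements
    elements-unique = mapMaybe-unique fromSubset fromSubset-injective (subsets-unique ∣H∣)

  open Algebra.Properties.Semiring.Exp ℂ.semiring using () renaming (_^_ to _^ᶜ_)

  instance
    _ : NonZero q
    _ = q-nonZero

  qᶜ q⁻¹ β : ℂ.Carrier
  qᶜ  = fromℚ (+ q / 1)
  q⁻¹ = fromℚ (+ 1 / q)
  β   = qᶜ ℂ.+ q⁻¹

  Matrix : Set _
  Matrix = X → X → ℂ.Carrier

  infix  4 _≋_
  infixl 6 _⊕_ _⊖_
  infixr 7 _⊙_
  infixl 8 _·_
  infixr 9 _^_

  _≋_ : Matrix → Matrix → Set _
  P ≋ Q = ∀ y z → P y z ℂ.≈ Q y z

  𝟘 𝟙 : Matrix
  𝟘 y z = ℂ.0#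
  𝟙 y z = if does (y ≟ z) then ℂ.1# else ℂ.0#

  _⊕_ _⊖_ _·_ : Matrix → Matrix → Matrix
  (P ⊕ Q) y z = P y z ℂ.+ Q y z
  (P ⊖ Q) y z = P y z ℂ.- Q y z
  (P · Q) y z = foldr (λ w s → P y w ℂ.* Q w z ℂ.+ s) ℂ.0# elements

  _⊙_ : ℂ.Carrier → Matrix → Matrix
  (r ⊙ P) y z = r ℂ.* P y z

  _^_ : Matrix → ℕ → Matrix
  P ^ zero  = 𝟙
  P ^ suc n = P · P ^ n

  A A* : Matrix
  A y z =
    if does (y covers? z) then ℂ.1# else
    if does (z covers? y) then qᶜ ^ᶜ rank y else
    ℂ.0#
  A* y z = if does (y ≟ z) then q⁻¹ ^ᶜ rank y else ℂ.0#

{-# OPTIONS --safe #-}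

-- Multiplying by A* on either side scales the (y , z) entry of A, so with
-- x = q ^ - dim y and w = q ^ - dim z the (y , z) entry of the left-hand side is
--   A y z (x ³ - (β + 1) x ² w + (β + 1) x w ² - w ³)
--     = A y z (x - w) (x - q w) (x - q ⁻¹ w),
-- which vanishes because A y z ≠ 0 forces dim y and dim z to differ by one.

module Submission where

open import Defs
open import Algebra.Bundles using (CommutativeMonoid; CommutativeRing)
open import Algebra.Module.Bundles using (Module)
import Algebra.Properties.AbelianGroup
import Algebra.Properties.Semiring.Exp
import Algebra.Solver.Ring.NaturalCoefficients.Default
open import Data.Bool.Base using (if_then_else_)
open import Data.Integer.Base using (+_)
open import Data.List.Base using (foldr; []; _∷_)
open import Data.List.Membership.Propositional using (_∈_)
open import Data.List.Relation.Unary.All as All using (All; []; _∷_)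
open import Data.List.Relation.Unary.Any using (here; there)
open import Data.List.Relation.Unary.Unique.Propositional using (Unique; _∷_)
open import Data.Nat.Base using (ℕ; suc; NonZero; _+_)
open import Data.Product.Base using (_,_)
open import Data.Rational.Base as ℚ using (1ℚ; _/_)
import Data.Rational.Properties as ℚ
import Data.Rational.Unnormalised.Base as ℚᵘ
import Data.Rational.Unnormalised.Properties as ℚᵘ
open import Data.Refinement using (value)
open import Function.Base using (_∘_)
open import Relation.Binary.PropositionalEquality as ≡ using (_≡_; _≢_)
import Relation.Binary.Reasoning.Setoid as ≈-Reasoning
open import Relation.Nullary.Decidable using (Dec; yes; no; does; dec-true; dec-false)
open import Relation.Nullary.Negation using (¬_)
open import Relation.Unary using (U)

module _ {a p} {A : Set a} {P : Set p} {x y : A} (P? : Dec P) where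

  if-yes : P → (if does P? then x else y) ≡ x
  if-yes p = ≡.cong (if_then x else y) (dec-true P? p)

  if-no : ¬ P → (if does P? then x else y) ≡ y
  if-no ¬p = ≡.cong (if_then x else y) (dec-false P? ¬p)

module _ {c ℓ} (M : CommutativeMonoid c ℓ) where

  open CommutativeMonoid M

  module _ {a} {A : Set a} (f : A → Carrier) where

    foldr-ε : ∀ {xs} → All (λ x → f x ≈ ε) xs → foldr (λ x s → f x ∙ s) ε xs ≈ ε
    foldr-ε []         = refl
    foldr-ε (eq ∷ eqs) = trans (∙-cong eq (foldr-ε eqs)) (identityˡ ε)

    -- Uniqueness keeps `f x` from being counted twice. This collapses the sum in a matrix product
    -- when one factor is diagonal.
    foldr-single : ∀ {x xs} → Unique xs → x ∈ xs → (∀ {y} → x ≢ y → f y ≈ ε) →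
      foldr (λ y s → f y ∙ s) ε xs ≈ f x
    foldr-single (x∉ ∷ _) (here ≡.refl) f≈ε =
      trans (∙-congˡ (foldr-ε (All.map f≈ε x∉))) (identityʳ _)
    foldr-single (y∉ ∷ unique) (there x∈) f≈ε =
      trans (∙-cong (f≈ε (All.lookup y∉ x∈ ∘ ≡.sym)) (foldr-single unique x∈ f≈ε)) (identityˡ _)

module _ {c ℓ} (R : CommutativeRing c ℓ) where

  open CommutativeRing R using
    (Carrier; _≈_; 0#; 1#; setoid; refl; commutativeSemiring; semiring;
     +-abelianGroup; +-cong; +-congˡ; +-congʳ; *-congˡ; *-congʳ; -‿inverseʳ;
     +-comm; *-comm; _*_; _-_; -_)
    renaming (_+_ to _⊹_)
  open Algebra.Properties.Semiring.Exp semiring using (_^_)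
  open Algebra.Solver.Ring.NaturalCoefficients.Default commutativeSemiring
    using (Polynomial; solve; _:=_; _:+_; _:*_; con)
  open ≈-Reasoning setoid

  -- Moving the negative terms across the equation leaves an identity without subtraction, which
  -- suits a solver for commutative semirings; here `- b` and `- d` enter it as atoms.
  alternating-sum : ∀ {a b c d} → a ⊹ c ≈ b ⊹ d → ((a - b) ⊹ c) - d ≈ 0#
  alternating-sum {a} {b} {c} {d} eq = begin
    ((a - b) ⊹ c) - d         ≈⟨ solve 4 (λ a b c d → (a :+ b) :+ c :+ d := (a :+ c) :+ (b :+ d)) refl a (- b) c (- d) ⟩
    (a ⊹ c) ⊹ (- b ⊹ - d)     ≈⟨ +-cong eq (⁻¹-∙-comm b d) ⟩
    (b ⊹ d) - (b ⊹ d)         ≈⟨ -‿inverseʳ (b ⊹ d) ⟩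
    0#                        ∎
    where open Algebra.Properties.AbelianGroup +-abelianGroup using (⁻¹-∙-comm)

  module _ {r s : Carrier} (rs≈1 : r * s ≈ 1#) where

    private
      b : Carrier
      b = (r ⊹ s) ⊹ 1#

    -- The case of the root `s * w`. After substitution both sides are multiples of `w ^ 3`. On the
    -- left `b * s` contributes `r * s`, on the right `b * s ^ 2` contributes `r * s * s`, and
    -- `r * s ≈ 1#` turns both coefficients into `s ^ 3 ⊹ s * s ⊹ s ⊹ 1#`.
    cubic-vanishes : ∀ {x w} → x ≈ s * w →
      x ^ 3 ⊹ b * (x * w ^ 2) ≈ b * (x ^ 2 * w) ⊹ w ^ 3
    cubic-vanishes {x} {w} x≈sw = begin
      x ^ 3 ⊹ b * (x * w ^ 2)
        ≈⟨ +-cong (^-congˡ 3 x≈sw) (*-congˡ (*-congʳ x≈sw)) ⟩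
      (s * w) ^ 3 ⊹ b * (s * w * w ^ 2)
        ≈⟨ solve 3 (λ r s w →
             cube (s :* w) :+ (r :+ s :+ con 1) :* (s :* w :* square w)
             := (cube s :+ s :* s :+ s :+ r :* s) :* cube w) refl r s w ⟩
      (s ^ 3 ⊹ s * s ⊹ s ⊹ r * s) * w ^ 3
        ≈⟨ *-congʳ (+-congˡ rs≈1) ⟩
      (s ^ 3 ⊹ s * s ⊹ s ⊹ 1#) * w ^ 3
        -- A factor `1` is inserted before `s`, to be expanded into `r * s` next.
        ≈⟨ solve 2 (λ s w → (cube s :+ s :* s :+ s :+ con 1) :* cube w
             := (cube s :+ s :* s :+ con 1 :* s :+ con 1) :* cube w) refl s w ⟩
      (s ^ 3 ⊹ s * s ⊹ 1# * s ⊹ 1#) * w ^ 3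
        ≈⟨ *-congʳ (+-congʳ (+-congˡ (*-congʳ rs≈1))) ⟨
      (s ^ 3 ⊹ s * s ⊹ r * s * s ⊹ 1#) * w ^ 3
        ≈⟨ solve 3 (λ r s w → (cube s :+ s :* s :+ r :* s :* s :+ con 1) :* cube w
             := (r :+ s :+ con 1) :* (square (s :* w) :* w) :+ cube w) refl r s w ⟩
      b * ((s * w) ^ 2 * w) ⊹ w ^ 3
        ≈⟨ +-congʳ (*-congˡ (*-congʳ (^-congˡ 2 x≈sw))) ⟨
      b * (x ^ 2 * w) ⊹ w ^ 3
        ∎
      where
      open Algebra.Properties.Semiring.Exp semiring using (^-congˡ)
      -- The trailing `con 1` mirrors how `p ^ 2` unfolds, to `p * (p * 1#)`.
      square cube : ∀ {n} → Polynomial n → Polynomial n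
      square p = p :* (p :* con 1)
      cube   p = p :* square p

    -- Exchanging `x` and `w` exchanges the two sides, so this is the previous equation read
    -- backwards.
    cubic-vanishes′ : ∀ {x w} → w ≈ s * x →
      x ^ 3 ⊹ b * (x * w ^ 2) ≈ b * (x ^ 2 * w) ⊹ w ^ 3
    cubic-vanishes′ {x} {w} w≈sx = begin
      x ^ 3 ⊹ b * (x * w ^ 2) ≈⟨ +-comm _ _ ⟩
      b * (x * w ^ 2) ⊹ x ^ 3 ≈⟨ +-congʳ (*-congˡ (*-comm x (w ^ 2))) ⟩
      b * (w ^ 2 * x) ⊹ x ^ 3 ≈⟨ cubic-vanishes w≈sx ⟨
      w ^ 3 ⊹ b * (w * x ^ 2) ≈⟨ +-comm _ _ ⟩
      b * (w * x ^ 2) ⊹ w ^ 3 ≈⟨ +-congʳ (*-congˡ (*-comm w (x ^ 2))) ⟩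
      b * (x ^ 2 * w) ⊹ w ^ 3 ∎

  -- The cubic equation is assumed only after multiplication by `e`, since for a zero entry `e` the
  -- cubic itself need not vanish.
  weighted-alternating-sum : ∀ {b x w e t₁ t₂ t₃ t₄} →
    t₁ ≈ x ^ 3 * e → t₂ ≈ (x ^ 2 * e) * w → t₃ ≈ (x * e) * w ^ 2 → t₄ ≈ e * w ^ 3 →
    (x ^ 3 ⊹ b * (x * w ^ 2)) * e ≈ (b * (x ^ 2 * w) ⊹ w ^ 3) * e →
    ((t₁ - b * t₂) ⊹ b * t₃) - t₄ ≈ 0#
  weighted-alternating-sum {b} {x} {w} {e} {t₁} {t₂} {t₃} {t₄} eq₁ eq₂ eq₃ eq₄ eq = alternating-sum (begin
    t₁ ⊹ b * t₃
      ≈⟨ +-cong eq₁ (*-congˡ eq₃) ⟩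
    x ^ 3 * e ⊹ b * ((x * e) * w ^ 2)
      ≈⟨ solve 5 (λ b x x³ w² e → x³ :* e :+ b :* ((x :* e) :* w²)
           := (x³ :+ b :* (x :* w²)) :* e) refl b x (x ^ 3) (w ^ 2) e ⟩
    (x ^ 3 ⊹ b * (x * w ^ 2)) * e
      ≈⟨ eq ⟩
    (b * (x ^ 2 * w) ⊹ w ^ 3) * e
      ≈⟨ solve 5 (λ b x² w w³ e → (b :* (x² :* w) :+ w³) :* e
           := b :* ((x² :* e) :* w) :+ e :* w³) refl b (x ^ 2) w (w ^ 3) e ⟩
    b * ((x ^ 2 * e) * w) ⊹ e * w ^ 3
      ≈⟨ +-cong (*-congˡ eq₂) eq₄ ⟨
    b * t₂ ⊹ t₄
      ∎)

-- `_/_` reduces to lowest terms, so the product is computed with unnormalised fractions instead.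
q*1/q≡1 : ∀ q .{{_ : NonZero q}} → (+ q / 1) ℚ.* (+ 1 / q) ≡ 1ℚ
q*1/q≡1 (suc n) = ℚ.toℚᵘ-injective (begin
  ℚ.toℚᵘ ((+ suc n / 1) ℚ.* (+ 1 / suc n))
    ≈⟨ ℚ.toℚᵘ-homo-* (+ suc n / 1) (+ 1 / suc n) ⟩
  ℚ.toℚᵘ (+ suc n / 1) ℚᵘ.* ℚ.toℚᵘ (+ 1 / suc n)
    -- `mkℚᵘ` stores the denominator minus one: `0` and `n` stand for `1` and `suc n`.
    ≈⟨ ℚᵘ.*-cong (ℚ.toℚᵘ-fromℚᵘ (ℚᵘ.mkℚᵘ (+ suc n) 0)) (ℚ.toℚᵘ-fromℚᵘ (ℚᵘ.mkℚᵘ (+ 1) n)) ⟩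
  ℚᵘ.mkℚᵘ (+ suc n) 0 ℚᵘ.* ℚᵘ.mkℚᵘ (+ 1) n
    ≈⟨ ℚᵘ.*-inverseʳ (ℚᵘ.mkℚᵘ (+ suc n) 0) ⟩
  ℚᵘ.1ℚᵘ
    ∎)
  where open ≈-Reasoning ℚᵘ.≃-setoid

fromℚ-homo-* : ∀ p r → fromℚ p ℂ.* fromℚ r ℂ.≈ fromℚ (p ℚ.* r)
fromℚ-homo-* p r = AdjoinI._,_
  (Real.pointwise λ _ → ≡.trans (≡.cong (p ℚ.* r ℚ.+_) (≡.cong ℚ.-_ (ℚ.*-zeroʳ ℚ.0ℚ))) (ℚ.+-identityʳ (p ℚ.* r)))
  (Real.pointwise λ _ → ≡.trans (≡.cong₂ ℚ._+_ (ℚ.*-zeroʳ p) (ℚ.*-zeroˡ r)) (ℚ.+-identityʳ ℚ.0ℚ))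

module Entries
  {c ℓ₁ ℓ₂ m ℓm} {q : ℕ} (F : FiniteField c ℓ₁ ℓ₂ q)
  (H : Module (FiniteField.commutativeRing F) m ℓm) {d : ℕ}
  (basis : VectorSpace.HasDimension F H U d)
  (h : VectorSpace.Finite.Subspace F H basis) where

  open AttenuatedSpace F H basis h
  open Algebra.Properties.Semiring.Exp ℂ.semiring using () renaming (_^_ to _^ᶜ_)
  open ≈-Reasoning ℂ.setoid

  diagonal : (X → ℂ.Carrier) → Matrix
  diagonal f y z = if does (y ≟ z) then f y else ℂ.0#

  diagonal-≡ : ∀ f y → diagonal f y y ≡ f y
  diagonal-≡ f y = if-yes (y ≟ y) ≡.refl

  diagonal-≢ : ∀ f {y z} → y ≢ z → diagonal f y z ≡ ℂ.0#
  diagonal-≢ f {y} {z} = if-no (y ≟ z)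

  ≋-refl : ∀ {P : Matrix} (y z : X) → P y z ℂ.≈ P y z
  ≋-refl _ _ = ℂ.refl

  infixr 8 _▷_
  infixl 8 _◁_

  _▷_ : (X → ℂ.Carrier) → Matrix → Matrix
  (f ▷ P) y z = f y ℂ.* P y z

  _◁_ : Matrix → (X → ℂ.Carrier) → Matrix
  (P ◁ f) y z = P y z ℂ.* f z

  -- In the lemmas leading to the theorem the conclusion is spelled with a visible
  -- Π instead of _≋_, so that Agda matches it against the goal before it looks at
  -- the premises.  The implicit matrices are then read off the goal one product at
  -- a time; comparing the products of the theorem as a whole is exponential.
  diagonal-· : ∀ f R {P Q} → P ≋ diagonal f → Q ≋ R →
    ∀ (y z : X) → (P · Q) y z ℂ.≈ (f ▷ R) y z
  diagonal-· f R {P} {Q} P≋ Q≋ y z = begin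
    (P · Q) y z       ≈⟨ foldr-single ℂ.+-commutativeMonoid (λ w → P y w ℂ.* Q w z)
                           elements-unique (elements-complete y) (λ {w} y≢w →
                             ℂ.trans (ℂ.*-congʳ (ℂ.trans (P≋ y w) (ℂ.reflexive (diagonal-≢ f y≢w))))
                               (ℂ.zeroˡ _)) ⟩
    P y y ℂ.* Q y z   ≈⟨ ℂ.*-cong (ℂ.trans (P≋ y y) (ℂ.reflexive (diagonal-≡ f y))) (Q≋ y z) ⟩
    f y ℂ.* R y z     ∎

  -- Column `z` of a diagonal matrix is zero away from row `z`, so only the summand at `z` survives.
  ·-diagonal : ∀ R f {Q P} → Q ≋ R → P ≋ diagonal f →
    ∀ (y z : X) → (Q · P) y z ℂ.≈ (R ◁ f) y z
  ·-diagonal R f {Q} {P} Q≋ P≋ y z = begin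
    (Q · P) y z       ≈⟨ foldr-single ℂ.+-commutativeMonoid (λ w → Q y w ℂ.* P w z)
                           elements-unique (elements-complete z) (λ {w} z≢w →
                             ℂ.trans (ℂ.*-congˡ (ℂ.trans (P≋ w z) (ℂ.reflexive (diagonal-≢ f (z≢w ∘ ≡.sym)))))
                               (ℂ.zeroʳ _)) ⟩
    Q y z ℂ.* P z z   ≈⟨ ℂ.*-cong (Q≋ y z) (ℂ.trans (P≋ z z) (ℂ.reflexive (diagonal-≡ f z))) ⟩
    R y z ℂ.* f z     ∎

  θ : X → ℂ.Carrier
  θ y = q⁻¹ ^ᶜ rank y

  θ^ : ℕ → X → ℂ.Carrier
  θ^ n y = θ y ^ᶜ n

  -- The induction step for powers of `A*`. By unfolding, `A*` is `diagonal θ` and `𝟙` is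
  -- `diagonal (θ^ 0)`, so `≋-refl` supplies both the base case and each new factor.
  θ^-suc : ∀ n {P Q} → P ≋ diagonal θ → Q ≋ diagonal (θ^ n) →
    ∀ (y z : X) → (P · Q) y z ℂ.≈ diagonal (θ^ (suc n)) y z
  θ^-suc n P≋ Q≋ y z = ℂ.trans (diagonal-· θ (diagonal (θ^ n)) P≋ Q≋ y z) (scaled (y ≟ z))
    where
    scaled : Dec (y ≡ z) → θ y ℂ.* diagonal (θ^ n) y z ℂ.≈ diagonal (θ^ (suc n)) y z
    scaled (yes ≡.refl) = ℂ.trans (ℂ.*-congˡ (ℂ.reflexive (diagonal-≡ (θ^ n) y)))
      (ℂ.reflexive (≡.sym (diagonal-≡ (θ^ (suc n)) y)))
    scaled (no y≢z) = ℂ.trans (ℂ.*-congˡ (ℂ.reflexive (diagonal-≢ (θ^ n) y≢z)))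
      (ℂ.trans (ℂ.zeroʳ (θ y)) (ℂ.reflexive (≡.sym (diagonal-≢ (θ^ (suc n)) y≢z))))

  θ-covers : ∀ {y z} → z Covers y → θ z ℂ.≈ q⁻¹ ℂ.* θ y
  θ-covers (_ , eq) = ℂ.reflexive (≡.cong (q⁻¹ ^ᶜ_) eq)

  A-nonadjacent : ∀ {y z} → ¬ y Covers z → ¬ z Covers y → A y z ≡ ℂ.0#
  A-nonadjacent {y} {z} y⋗̸z z⋗̸y = ≡.trans (if-no (y covers? z) y⋗̸z) (if-no (z covers? y) z⋗̸y)

  qᶜ*q⁻¹≈1 : qᶜ ℂ.* q⁻¹ ℂ.≈ ℂ.1#
  qᶜ*q⁻¹≈1 = ℂ.trans (fromℚ-homo-* _ _)
    (ℂ.reflexive (≡.cong fromℚ (q*1/q≡1 q {{VectorSpace.q-nonZero F H}})))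

  -- If `y` and `z` are adjacent, the two cubics already agree; otherwise `A y z` is zero.
  cubic*A : ∀ y z →
    (θ y ^ᶜ 3 ℂ.+ (β ℂ.+ ℂ.1#) ℂ.* (θ y ℂ.* θ z ^ᶜ 2)) ℂ.* A y z ℂ.≈
    ((β ℂ.+ ℂ.1#) ℂ.* (θ y ^ᶜ 2 ℂ.* θ z) ℂ.+ θ z ^ᶜ 3) ℂ.* A y z
  cubic*A y z = by-adjacency (y covers? z) (z covers? y)
    where
    u v : ℂ.Carrier
    u = θ y ^ᶜ 3 ℂ.+ (β ℂ.+ ℂ.1#) ℂ.* (θ y ℂ.* θ z ^ᶜ 2)
    v = (β ℂ.+ ℂ.1#) ℂ.* (θ y ^ᶜ 2 ℂ.* θ z) ℂ.+ θ z ^ᶜ 3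

    vanish : ∀ r → ¬ y Covers z → ¬ z Covers y → r ℂ.* A y z ℂ.≈ ℂ.0#
    vanish r y⋗̸z z⋗̸y = ℂ.trans (ℂ.*-congˡ {r} (ℂ.reflexive (A-nonadjacent {y} {z} y⋗̸z z⋗̸y))) (ℂ.zeroʳ r)

    by-adjacency : Dec (y Covers z) → Dec (z Covers y) → u ℂ.* A y z ℂ.≈ v ℂ.* A y z
    -- Going down from `y` to `z` gives the root `θ y = q⁻¹ θ z`; the next clause, going up, gives
    -- `θ y = q θ z`.
    by-adjacency (yes y⋗z) _ = ℂ.*-congʳ {A y z} {u} {v}
      (cubic-vanishes ℂ-commutativeRing {qᶜ} {q⁻¹} qᶜ*q⁻¹≈1 {θ y} {θ z} (θ-covers {z} {y} y⋗z))
    by-adjacency (no _) (yes z⋗y) = ℂ.*-congʳ {A y z} {u} {v}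
      (cubic-vanishes′ ℂ-commutativeRing {qᶜ} {q⁻¹} qᶜ*q⁻¹≈1 {θ y} {θ z} (θ-covers {y} {z} z⋗y))
    by-adjacency (no y⋗̸z) (no z⋗̸y) = ℂ.trans (vanish u y⋗̸z z⋗̸y) (ℂ.sym (vanish v y⋗̸z z⋗̸y))

  relation-from-entries : ∀ {P₁ P₂ P₃ P₄} →
    P₁ ≋ θ^ 3 ▷ A → P₂ ≋ (θ^ 2 ▷ A) ◁ θ → P₃ ≋ (θ ▷ A) ◁ θ^ 2 → P₄ ≋ A ◁ θ^ 3 →
    ∀ (y z : X) → (P₁ ⊖ (β ℂ.+ ℂ.1#) ⊙ P₂ ⊕ (β ℂ.+ ℂ.1#) ⊙ P₃ ⊖ P₄) y z ℂ.≈ 𝟘 y z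
  relation-from-entries {P₁} {P₂} {P₃} {P₄} P₁≋ P₂≋ P₃≋ P₄≋ y z = weighted-alternating-sum ℂ-commutativeRing
    {β ℂ.+ ℂ.1#} {θ y} {θ z} {A y z} {P₁ y z} {P₂ y z} {P₃ y z} {P₄ y z}
    (P₁≋ y z) (P₂≋ y z) (P₃≋ y z) (P₄≋ y z) (cubic*A y z)

proposition8p7 : ∀ {c ℓ₁ ℓ₂ m ℓm} {q : ℕ} (F : FiniteField c ℓ₁ ℓ₂ q)
    (H : Module (FiniteField.commutativeRing F) m ℓm)
    (N M : ℕ) .{{_ : NonZero N}} .{{_ : NonZero M}} →
    let open VectorSpace F H in
    (basis : HasDimension U (N + M)) →
    let open Finite basis in
    (h : Subspace) → HasDimension (_∈ᴴ value h) M →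
    let open AttenuatedSpace F H basis h in
    A* ^ 3 · A
    ⊖ (β ℂ.+ ℂ.1#) ⊙ (A* ^ 2 · A · A*)
    ⊕ (β ℂ.+ ℂ.1#) ⊙ (A* · A · A* ^ 2)
    ⊖ A · A* ^ 3
    ≋ 𝟘
proposition8p7 F H N M basis h _ = relation-from-entries
  -- Each nested `θ^-suc` peels one `A*` off a power. As `_·_` associates to the left, the two
  -- middle products are scaled on the left first and on the right last.
  (diagonal-· (θ^ 3) A (θ^-suc 2 ≋-refl (θ^-suc 1 ≋-refl (θ^-suc 0 ≋-refl ≋-refl))) ≋-refl)
  (·-diagonal (θ^ 2 ▷ A) θ (diagonal-· (θ^ 2) A (θ^-suc 1 ≋-refl (θ^-suc 0 ≋-refl ≋-refl)) ≋-refl) ≋-refl)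
  (·-diagonal (θ ▷ A) (θ^ 2) (diagonal-· θ A ≋-refl ≋-refl) (θ^-suc 1 ≋-refl (θ^-suc 0 ≋-refl ≋-refl)))
  (·-diagonal A (θ^ 3) ≋-refl (θ^-suc 2 ≋-refl (θ^-suc 1 ≋-refl (θ^-suc 0 ≋-refl ≋-refl))))
  where
  open AttenuatedSpace F H basis h
  open Entries F H basis h
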